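{- Let $m,n\ge 1$ be integers and let $k_1,\dots,k_n$ be non-negative integers. If $m\ge k_1+k_2+\cdots+k_n+n-1$, then the simplicial complex $\Delta_{m,n}^{k_1,\dots,k_n;\mathbf{1}}$ is shellable.
   Context: Write $[t]=\{1,\dots,t\}$. The chessboard $[m]\times[n]$ has $n$ rows $[m]\times\{i\}$ ($i\in[n]$), each of length $m$, and $m$ columns $\{j\}\times[n]$ ($j\in[m]$). The complex $\Delta_{m,n}^{k_1,\dots,k_n;\mathbf{1}}$ is the simplicial complex whose simplices are the subsets $A\subset[m]\times[n]$ (rook placements) such that $|A\cap([m]\times\{i\})|\le k_i$ for every $i\in[n]$ (at most $k_i$ rooks in the $i$-th row) and $|A\cap(\{j\}\times[n])|\le 1$ for every $j\in[m]$ (at most one rook in each column). A pure finite simplicial complex is shellable if there is a linear order $\ll$ on its facets (a shelling order) such that for every pair of facets $A\ll B$ there exist a facet $C\ll B$ and a vertex $v\in B$ with $A\cap B\subset C\cap B=B\setminus\{v\}$. -}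

module Defs where

open import Level using (0ℓ)
open import Data.Nat using (ℕ; _*_; _≤_; z≤n)
open import Data.Nat.Properties using (≤-trans; ≤-reflexive)
open import Data.Fin using (Fin; quotient; remainder)
open import Data.Fin.Properties using (_≟_)
open import Data.Fin.Subset using (Subset; ⊥; _∈_; _⊆_; _∩_; _-_; ∣_∣)
open import Data.Fin.Subset.Properties
  using (p⊆q⇒∣p∣≤∣q∣; ∩-zeroˡ; ∣⊥∣≡0; x∈p∩q⁺; x∈p∩q⁻)
open import Data.Product using (_×_; _,_; proj₁; ∃; ∃-syntax; map₁)
open import Data.Vec using (Vec; lookup; tabulate)
open import Function using (_∘_; _on_)
open import Relation.Binary using (Rel; IsStrictTotalOrder)
open import Relation.Binary.PropositionalEquality using (_≡_; cong; trans)
open import Relation.Nullary using (does)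
open import Relation.Unary using (Pred)

-- The empty set counts as a simplex; a point of the ground set Fin N need not
-- itself be a vertex of the complex.
record SimplicialComplex (N : ℕ) : Set₁ where
  field
    Simplex   : Pred (Subset N) 0ℓ
    ⊥-simplex : Simplex ⊥
    ⊆-closed  : ∀ {A B} → A ⊆ B → Simplex B → Simplex A

module _ {N : ℕ} (K : SimplicialComplex N) where
  open SimplicialComplex K

  IsFacet : Pred (Subset N) 0ℓ
  IsFacet A = Simplex A × (∀ B → Simplex B → A ⊆ B → A ≡ B)

  Facet : Set
  Facet = ∃ IsFacet

  -- Facets are compared as sets of vertices, ignoring the proof of maximality.
  _≈_ : Rel Facet 0ℓ
  _≈_ = _≡_ on proj₁

  Pure : Set
  Pure = ∀ (F G : Facet) → ∣ proj₁ F ∣ ≡ ∣ proj₁ G ∣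

  record IsShellingOrder (_≪_ : Rel Facet 0ℓ) : Set where
    field
      isStrictTotalOrder : IsStrictTotalOrder _≈_ _≪_
      shelling : ∀ (F G : Facet) → F ≪ G →
        let A = proj₁ F ; B = proj₁ G in
        ∃[ H ] H ≪ G × (let C = proj₁ H in
          ∃[ v ] v ∈ B × A ∩ B ⊆ C ∩ B × C ∩ B ≡ B - v)

  Shellable : Set₁
  Shellable = Pure × ∃ IsShellingOrder

-- The square (j , i) of the board [m] × [n] is the element combine j i of
-- Fin (m * n), so quotient reads off its column j and remainder its row i.
module _ (m n : ℕ) where

  row : Fin n → Subset (m * n)
  row i = tabulate λ x → does (remainder {m} n x ≟ i)

  column : Fin m → Subset (m * n)
  column j = tabulate λ x → does (quotient {m} n x ≟ j)

module _ (m n : ℕ) (k : Vec ℕ n) where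

  RookPlacement : Pred (Subset (m * n)) 0ℓ
  RookPlacement A = (∀ i → ∣ A ∩ row m n i ∣ ≤ lookup k i)
                  × (∀ j → ∣ A ∩ column m n j ∣ ≤ 1)

  Chessboard : SimplicialComplex (m * n)
  Chessboard = record
    { Simplex   = RookPlacement
    ; ⊥-simplex = (λ i → empty (row m n i)) , (λ j → empty (column m n j))
    ; ⊆-closed  = λ A⊆B (rows , columns) →
          (λ i → ≤-trans (mono (row m n i) A⊆B) (rows i))
        , (λ j → ≤-trans (mono (column m n j) A⊆B) (columns j))
    }
    where
    empty : ∀ {b} (S : Subset (m * n)) → ∣ ⊥ ∩ S ∣ ≤ b
    empty S = ≤-trans
      (≤-reflexive (trans (cong ∣_∣ (∩-zeroˡ S)) (∣⊥∣≡0 (m * n)))) z≤n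

    mono : ∀ {A B} (S : Subset (m * n)) → A ⊆ B → ∣ A ∩ S ∣ ≤ ∣ B ∩ S ∣
    mono {A} {B} S A⊆B =
      p⊆q⇒∣p∣≤∣q∣ (x∈p∩q⁺ ∘ map₁ A⊆B ∘ x∈p∩q⁻ A S)

{-# OPTIONS --safe #-}
module Submission where

-- A facet is a word of length m in which each column carries the row of its
-- rook or no rook at all, row i occurring exactly k i times. Facets are compared
-- lexicographically, the order of the letters at a column depending on the number
-- c of empty columns before it: row c comes first, then the empty letter, then
-- the other rows. If b is larger than a, some rook of b not in a can be moved
-- within its row to an empty column of b so that b decreases. At the first
-- difference of a and b, either b has no rook and a has row c, so a later rook of
-- b in row c comes forward; or b has a row i ≠ c. If i < c (rows and columns are
-- counted from 0), that rook moves back to the i-th empty column, where row i came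
-- first; if i > c, then c < n - 1, so there is a later empty column to move it to.

open import Defs
open import Data.Fin using (Fin; zero; suc; toℕ; combine; remQuot; _↑ˡ_; _↑ʳ_)
open import Data.Fin.Properties
  using (_≟_; toℕ-injective; toℕ<n; splitAt-↑ʳ; remQuot-combine; combine-surjective)
open import Data.Fin.Subset
  using (Subset; inside; outside; ⊥; ⊤; ⁅_⁆; _∈_; _∉_; _⊆_; _∩_; _-_; ∣_∣)
open import Data.Fin.Subset.Properties
  using (_∈?_; ∉⊥; ∣⊥∣≡0; x∈⁅x⁆; x∈⁅y⁆⇒x≡y; ∣⁅x⁆∣≡1; Empty-unique; ⊆-antisym; ⊂-irref;
         p⊂q⇒∣p∣<∣q∣; x∈p∩q⁺; x∈p∩q⁻; p─q⊆p; p─q─q≡p─q; x∈p⇒p-x⊂p; x∈p∧x≢y⇒x∈p-y;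
         ∩-zeroʳ; ∩-idem; ∩-identityʳ)
open import Data.Maybe using (Maybe; just; nothing)
open import Data.Maybe.Properties using (≡-dec; just-injective)
open import Data.Nat as ℕ using (ℕ; zero; suc; _+_; _*_; _∸_; _≤_; _<_; _≥_; s≤s; s<s⁻¹; z≤n)
import Data.Nat.Properties as ℕ
open import Data.Product using (_×_; _,_; proj₁; proj₂; ∃-syntax; map₁)
open import Data.Sum using (_⊎_; inj₁; inj₂)
open import Data.Vec
  using (Vec; []; _∷_; _++_; head; lookup; tabulate; updateAt; replicate; splitAt; sum; _[_]≔_)
open import Data.Vec.Properties
  using (lookup∘updateAt; lookup∘updateAt′; lookup∘update; lookup∘update′; updateAt-commutes;
         ∷-injectiveʳ; tabulate-cong; zipWith-++; lookup-++ˡ; lookup-++ʳ; ++-injective;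
         lookup⇒[]=; []=⇒lookup)
import Data.Vec.Relation.Binary.Pointwise.Extensional as Pointwise
open import Function using (_∘_; _on_; _⇔_; mk⇔; Equivalence)
open import Relation.Binary
  using (Rel; Trichotomous; tri<; tri≈; tri>; DecidableEquality; IsStrictTotalOrder)
import Relation.Binary.Construct.On as On
open import Relation.Binary.PropositionalEquality
open import Relation.Binary.Structures.Biased using (isStrictTotalOrderᶜ)
open import Relation.Nullary using (yes; no; ¬_; does; contradiction)

private
  variable
    m n c : ℕ

-- Words, their empty columns and their row counts

Slot : ℕ → Set
Slot n = Maybe (Fin n)

Word : ℕ → ℕ → Set
Word m n = Vec (Slot n) m

_≟ˢ_ : DecidableEquality (Slot n)
_≟ˢ_ = ≡-dec _≟_

gap : Slot n → ℕ
gap nothing  = 1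
gap (just _) = 0

free : Word m n → ℕ
free []      = 0
free (x ∷ w) = gap x + free w

add : Slot n → Vec ℕ n → Vec ℕ n
add nothing  v = v
add (just i) v = updateAt v i suc

content : Word m n → Vec ℕ n
content []      = replicate _ 0
content (x ∷ w) = add x (content w)

lookup-add : ∀ (i : Fin n) v → lookup (add (just i) v) i ≡ suc (lookup v i)
lookup-add i v = lookup∘updateAt i v

lookup-add-≢ : ∀ {x} {i : Fin n} v → x ≢ just i → lookup (add x v) i ≡ lookup v i
lookup-add-≢ {x = nothing} v x≢i = refl
lookup-add-≢ {x = just j}  v x≢i = lookup∘updateAt′ _ j (x≢i ∘ cong just ∘ sym) v

lookup≤lookup-add : ∀ x (i : Fin n) v → lookup v i ≤ lookup (add x v) i
lookup≤lookup-add x i v with x ≟ˢ just i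
... | yes refl = ℕ.≤-trans (ℕ.n≤1+n _) (ℕ.≤-reflexive (sym (lookup-add i v)))
... | no x≢i   = ℕ.≤-reflexive (sym (lookup-add-≢ v x≢i))

add-comm : ∀ x y (v : Vec ℕ n) → add x (add y v) ≡ add y (add x v)
add-comm nothing  y        v = refl
add-comm (just i) nothing  v = refl
add-comm (just i) (just j) v with i ≟ j
... | yes refl = refl
... | no i≢j   = updateAt-commutes i j i≢j v

add-injective : ∀ x {u v : Vec ℕ n} → add x u ≡ add x v → u ≡ v
add-injective nothing eq = eq
add-injective (just zero)    {x ∷ u} {.x ∷ .u} refl = refl
add-injective (just (suc i)) {x ∷ u} {y ∷ v} eq =
  cong₂ _∷_ (cong head eq) (add-injective (just i) (∷-injectiveʳ eq))

sum-add : ∀ x (v : Vec ℕ n) → gap x + sum (add x v) ≡ suc (sum v)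
sum-add nothing         v       = refl
sum-add (just zero)     (y ∷ v) = refl
sum-add (just (suc i))  (y ∷ v) =
  trans (cong (y +_) (sum-add (just i) v)) (ℕ.+-suc y (sum v))

sum-replicate-0 : ∀ n → sum (replicate n 0) ≡ 0
sum-replicate-0 zero    = refl
sum-replicate-0 (suc n) = sum-replicate-0 n

-- Every letter raises exactly one of the two summands by one: an empty letter raises `free`, a rook
-- raises one entry of `content`.
free+sum-content : (w : Word m n) → free w + sum (content w) ≡ m
free+sum-content {n = n} [] = sum-replicate-0 n
free+sum-content (x ∷ w) = begin
  gap x + free w + sum (add x (content w))
    ≡⟨ cong (_+ sum (content (x ∷ w))) (ℕ.+-comm (gap x) (free w)) ⟩
  free w + gap x + sum (add x (content w))   ≡⟨ ℕ.+-assoc (free w) _ _ ⟩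
  free w + (gap x + sum (add x (content w))) ≡⟨ cong (free w +_) (sum-add x (content w)) ⟩
  free w + suc (sum (content w))             ≡⟨ ℕ.+-suc (free w) _ ⟩
  suc (free w + sum (content w))             ≡⟨ cong suc (free+sum-content w) ⟩
  suc _                                      ∎
  where open ≡-Reasoning

-- The removed letter is added back on the left instead of being subtracted on the right, so no
-- truncated subtraction occurs.
content-≔ : ∀ (w : Word m n) p x →
  add (lookup w p) (content (w [ p ]≔ x)) ≡ add x (content w)
content-≔ (y ∷ w) zero    x = add-comm y x (content w)
content-≔ (y ∷ w) (suc p) x = begin
  add (lookup w p) (add y (content (w [ p ]≔ x))) ≡⟨ add-comm (lookup w p) y _ ⟩
  add y (add (lookup w p) (content (w [ p ]≔ x))) ≡⟨ cong (add y) (content-≔ w p x) ⟩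
  add y (add x (content w))                       ≡⟨ add-comm y x _ ⟩
  add x (add y (content w))                       ∎
  where open ≡-Reasoning

free-position : (w : Word m n) → (∃[ q ] lookup w q ≡ nothing) ⊎ free w ≡ 0
free-position []            = inj₂ refl
free-position (nothing ∷ w) = inj₁ (zero , refl)
free-position (just i ∷ w)  with free-position w
... | inj₁ (q , eq) = inj₁ (suc q , eq)
... | inj₂ none     = inj₂ none

-- Stripping a pair of heads `just i` lowers both counts by one. If only the head of `b` differs
-- from `just i`, the count of `b` is unchanged and that of `a` cannot grow, so the strict
-- inequality persists until a witness appears.
content-<⇒position : ∀ (a b : Word m n) i → lookup (content a) i < lookup (content b) i →
  ∃[ p ] lookup b p ≡ just i × lookup a p ≢ just i
content-<⇒position []      []      i lt = contradiction lt (ℕ.<-irrefl refl)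
content-<⇒position (x ∷ a) (y ∷ b) i lt with y ≟ˢ just i | x ≟ˢ just i
... | yes eq | no x≢i = zero , eq , x≢i
... | yes refl | yes refl
  with p , b≡ , a≢ ← content-<⇒position a b i
         (s<s⁻¹ (subst₂ _<_ (lookup-add i (content a)) (lookup-add i (content b)) lt))
  = suc p , b≡ , a≢
... | no y≢i | _
  with p , b≡ , a≢ ← content-<⇒position a b i
         (ℕ.≤-<-trans (lookup≤lookup-add x i (content a))
                      (subst (_ <_) (lookup-add-≢ (content b) y≢i) lt))
  = suc p , b≡ , a≢

-- The lexicographic order with varying letter order

rank : ℕ → Slot n → ℕ
rank c nothing  = 1
rank c (just i) with toℕ i ℕ.≟ c
... | yes _ = 0
... | no  _ = 2 + toℕ i

rank-injective : ∀ c {x y : Slot n} → rank c x ≡ rank c y → x ≡ y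
rank-injective c {nothing} {nothing} eq = refl
rank-injective c {nothing} {just j} eq with toℕ j ℕ.≟ c
rank-injective c {nothing} {just j} () | yes _
rank-injective c {nothing} {just j} () | no _
rank-injective c {just i} {nothing} eq with toℕ i ℕ.≟ c
rank-injective c {just i} {nothing} () | yes _
rank-injective c {just i} {nothing} () | no _
rank-injective c {just i} {just j} eq with toℕ i ℕ.≟ c | toℕ j ℕ.≟ c
... | yes i≡c | yes j≡c = cong just (toℕ-injective (trans i≡c (sym j≡c)))
... | no _    | no _    = cong just (toℕ-injective (ℕ.suc-injective (ℕ.suc-injective eq)))

rank-favoured : ∀ (i : Fin n) → toℕ i ≡ c → rank c (just i) ≡ 0
rank-favoured {c = c} i i≡c with toℕ i ℕ.≟ c
... | yes _  = refl
... | no i≢c = contradiction i≡c i≢c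

rank-≢ : ∀ (i : Fin n) → toℕ i ≢ c → rank c (just i) ≡ 2 + toℕ i
rank-≢ {c = c} i i≢c with toℕ i ℕ.≟ c
... | yes i≡c = contradiction i≡c i≢c
... | no _    = refl

rank<1 : ∀ {x : Slot n} → rank c x < 1 → ∃[ i ] x ≡ just i × toℕ i ≡ c
rank<1 {x = nothing} (s≤s ())
rank<1 {c = c} {x = just i} lt with toℕ i ℕ.≟ c
... | yes i≡c = i , refl , i≡c
rank<1 {x = just i} (s≤s ()) | no _

rank<⇒≢ : ∀ {x y : Slot n} → rank c x < rank c y → x ≢ y
rank<⇒≢ x<y refl = ℕ.<-irrefl refl x<y

infix 4 _⊢_≺_

-- The index counts the empty columns already passed. They lie in the common prefix, so both letters
-- at the first difference are ranked by the same `c`.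
data _⊢_≺_ {n} (c : ℕ) : Word m n → Word m n → Set where
  here  : ∀ {x y} {v w : Word m n} → rank c x < rank c y → c ⊢ x ∷ v ≺ y ∷ w
  there : ∀ {x} {v w : Word m n} → gap x + c ⊢ v ≺ w → c ⊢ x ∷ v ≺ x ∷ w

≺-trans : ∀ {u v w : Word m n} → c ⊢ u ≺ v → c ⊢ v ≺ w → c ⊢ u ≺ w
≺-trans (here x<y)  (here y<z)  = here (ℕ.<-trans x<y y<z)
≺-trans (here x<y)  (there _)   = here x<y
≺-trans (there _)   (here y<z)  = here y<z
≺-trans (there u≺v) (there v≺w) = there (≺-trans u≺v v≺w)

≺-irrefl : ∀ {w : Word m n} → ¬ (c ⊢ w ≺ w)
≺-irrefl (here lt)   = ℕ.<-irrefl refl lt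
≺-irrefl (there w≺w) = ≺-irrefl w≺w

≺-compare : ∀ c → Trichotomous {A = Word m n} _≡_ (c ⊢_≺_)
≺-compare c []      []      = tri≈ (λ ()) refl (λ ())
≺-compare c (x ∷ v) (y ∷ w) with ℕ.<-cmp (rank c x) (rank c y)
... | tri< x<y _ _ = tri< (here x<y) (λ { refl → ℕ.<-irrefl refl x<y })
                          (≺-irrefl ∘ ≺-trans (here x<y))
... | tri> _ _ y<x = tri> (≺-irrefl ∘ ≺-trans (here y<x))
                          (λ { refl → ℕ.<-irrefl refl y<x }) (here y<x)
-- Equal ranks force equal heads, so both tails are compared under one index.
... | tri≈ _ x≡y _ with refl ← rank-injective c {x} {y} x≡y | ≺-compare (gap x + c) v w
...   | tri< v≺w _ _  = tri< (there v≺w) (λ { refl → ≺-irrefl v≺w })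
                             (≺-irrefl ∘ ≺-trans (there v≺w))
...   | tri≈ _ refl _ = tri≈ ≺-irrefl refl ≺-irrefl
...   | tri> _ _ w≺v  = tri> (≺-irrefl ∘ ≺-trans (there w≺v))
                             (λ { refl → ≺-irrefl w≺v }) (there w≺v)

-- Moving a rook within its row to an empty column

exchange : Word m n → Fin m → Fin m → Fin n → Word m n
exchange b p q i = b [ p ]≔ nothing [ q ]≔ just i

content-exchange : ∀ (b : Word m n) {p q i} → lookup b p ≡ just i →
  lookup (b [ p ]≔ nothing) q ≡ nothing → content (exchange b p q i) ≡ content b
content-exchange b {p} {q} {i} bp≡i bq≡∅ = begin
  content (exchange b p q i)
    ≡⟨ cong (λ x → add x (content (exchange b p q i))) bq≡∅ ⟨
  add (lookup (b [ p ]≔ nothing) q) (content (exchange b p q i))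
    ≡⟨ content-≔ (b [ p ]≔ nothing) q (just i) ⟩
  add (just i) (content (b [ p ]≔ nothing))
    ≡⟨ cong (λ x → add x (content (b [ p ]≔ nothing))) bp≡i ⟨
  add (lookup b p) (content (b [ p ]≔ nothing))
    ≡⟨ content-≔ b p nothing ⟩
  content b ∎
  where open ≡-Reasoning

-- The square of row `i` in column `p` becomes the vertex removed from `b` in the shelling
-- condition: `a∌i` keeps it out of the intersection with `a`, and `b∋∅` ensures that no other rook
-- is displaced.
record Exchange (c : ℕ) (a b : Word m n) : Set where
  constructor exchanging
  field
    p q  : Fin m
    i    : Fin n
    b∋i  : lookup b p ≡ just i
    a∌i  : lookup a p ≢ just i
    b∋∅  : lookup b q ≡ nothing
    less : c ⊢ exchange b p q i ≺ b

-- The rook of b at p can be moved to the empty column with exactly toℕ i empty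
-- columns before it, which lies in the prefix already stripped from the words.
Deferred : ℕ → Word m n → Word m n → Set
Deferred c a b = ∃[ p ] ∃[ i ] lookup b p ≡ just i × lookup a p ≢ just i × toℕ i < c

exchange-∷ : ∀ x {a b : Word m n} →
  Exchange (gap x + c) a b → Exchange c (x ∷ a) (x ∷ b)
exchange-∷ x (exchanging p q i b∋i a∌i b∋∅ less) =
  exchanging (suc p) (suc q) i b∋i a∌i b∋∅ (there less)

deferred-∷ : ∀ x {a b : Word m n} → Deferred (gap x + c) a b →
  Exchange c (x ∷ a) (x ∷ b) ⊎ Deferred c (x ∷ a) (x ∷ b)
deferred-∷ (just _) (p , i , b∋i , a∌i , i<c) = inj₂ (suc p , i , b∋i , a∌i , i<c)
deferred-∷ nothing  (p , i , b∋i , a∌i , i<c) with ℕ.m≤n⇒m<n∨m≡n (ℕ.s≤s⁻¹ i<c)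
... | inj₁ i<c′ = inj₂ (suc p , i , b∋i , a∌i , i<c′)
-- Row `i` is the favoured row at this empty column, so placing it here lowers the rank from 1 to 0.
... | inj₂ i≡c  = inj₁ (exchanging (suc p) zero i b∋i a∌i refl
                    (here (subst (_< 1) (sym (rank-favoured i i≡c)) (s≤s z≤n))))

-- Induction along the common prefix. An empty head passes from `free b` to the index, so
-- `c + free b` is invariant; a common head cancels from the contents. A rook whose row is below `c`
-- is deferred, to be placed when the recursion returns to the empty column favouring that row.
exchangeable : ∀ {c} {a b : Word m n} → content a ≡ content b → n ≤ suc (c + free b) →
  c ⊢ a ≺ b → Exchange c a b ⊎ Deferred c a b
exchangeable {n = n} {c} {x ∷ a} {.x ∷ b} same enough (there a≺b)
  with exchangeable (add-injective x same) (subst (λ k → n ≤ suc k) moved enough) a≺b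
  where
  moved : c + (gap x + free b) ≡ gap x + c + free b
  moved = trans (sym (ℕ.+-assoc c (gap x) _)) (cong (_+ free b) (ℕ.+-comm c (gap x)))
... | inj₁ e = inj₁ (exchange-∷ x e)
... | inj₂ d = deferred-∷ x d
-- Only the favoured row ranks below the empty letter. Since `a` spends one of its rooks in that row
-- here, the tail of `b` has more of them than the tail of `a`.
exchangeable {c = c} {x ∷ a} {nothing ∷ b} same enough (here x<∅)
  with i , refl , i≡c ← rank<1 {c = c} {x = x} x<∅
  with p , b∋i , a∌i ← content-<⇒position a b i
         (ℕ.≤-reflexive (trans (sym (lookup-add i (content a))) (cong (λ v → lookup v i) same)))
  = inj₁ (exchanging (suc p) zero i b∋i a∌i refl (here x<∅))
exchangeable {n = n} {c} {x ∷ a} {just i ∷ b} same enough (here x<i)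
  with rank<⇒≢ {c = c} {y = just i} x<i | ℕ.<-cmp (toℕ i) c | free-position b
... | x≢i | tri< i<c _ _ | _ = inj₂ (zero , i , refl , x≢i , i<c)
... | x≢i | tri≈ _ i≡c _ | _ = contradiction (subst (rank c x <_) (rank-favoured i i≡c) x<i) λ ()
-- Vacating this column lowers its rank from `2 + toℕ i` to 1, so any later empty column can receive
-- the rook.
... | x≢i | tri> _ i≢c _ | inj₁ (q , bq≡∅) =
  inj₁ (exchanging zero (suc q) i refl x≢i bq≡∅
    (here (subst (1 <_) (sym (rank-≢ i i≢c)) (s≤s (s≤s z≤n)))))
... | x≢i | tri> _ _ i>c | inj₂ none =
  contradiction i>c (ℕ.≤⇒≯ (ℕ.s≤s⁻¹ (ℕ.<-≤-trans (toℕ<n i)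
    (subst (λ k → n ≤ suc k) (trans (cong (c +_) none) (ℕ.+-identityʳ c)) enough))))

-- At index 0 no column has been passed, so a deferred rook would need a row index below 0.
exchange-exists : ∀ {a b : Word m n} → content a ≡ content b → n ≤ suc (free b) →
  0 ⊢ a ≺ b → Exchange 0 a b
exchange-exists same enough a≺b with exchangeable same enough a≺b
... | inj₁ e = e
... | inj₂ (_ , _ , _ , _ , ())

-- Splitting the board into its first column and the rest

∣++∣ : ∀ (p : Subset m) (q : Subset n) → ∣ p ++ q ∣ ≡ ∣ p ∣ + ∣ q ∣
∣++∣ []            q = refl
∣++∣ (inside  ∷ p) q = cong suc (∣++∣ p q)
∣++∣ (outside ∷ p) q = ∣++∣ p q

∣++∩++∣ : ∀ (p r : Subset m) (q s : Subset n) →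
  ∣ (p ++ q) ∩ (r ++ s) ∣ ≡ ∣ p ∩ r ∣ + ∣ q ∩ s ∣
∣++∩++∣ p r q s = trans (cong ∣_∣ (zipWith-++ _ p q r s)) (∣++∣ (p ∩ r) (q ∩ s))

tabulate-++ : ∀ {A : Set} m {n} (f : Fin (m + n) → A) →
  tabulate f ≡ tabulate (f ∘ (_↑ˡ n)) ++ tabulate (f ∘ (m ↑ʳ_))
tabulate-++ zero    f = refl
tabulate-++ (suc m) f = cong (f zero ∷_) (tabulate-++ m (f ∘ suc))

tabulate-const : ∀ {A : Set} n (x : A) → tabulate {n = n} (λ _ → x) ≡ replicate n x
tabulate-const zero    x = refl
tabulate-const (suc n) x = cong (x ∷_) (tabulate-const n x)

tabulate-≟ : ∀ (i : Fin n) → tabulate (λ j → does (j ≟ i)) ≡ ⁅ i ⁆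
tabulate-≟ {suc n} zero    = cong (inside ∷_) (tabulate-const n outside)
tabulate-≟ {suc n} (suc i) = cong (outside ∷_) (tabulate-≟ i)

remQuot-↑ʳ : ∀ m n x → remQuot {suc m} n (n ↑ʳ x) ≡ map₁ suc (remQuot {m} n x)
remQuot-↑ʳ m n x rewrite splitAt-↑ʳ n (m * n) x = refl

row-suc : ∀ m n i → row (suc m) n i ≡ ⁅ i ⁆ ++ row m n i
row-suc m n i = trans (tabulate-++ n _) (cong₂ _++_
  (trans (tabulate-cong λ j → cong (λ x → does (proj₂ x ≟ i)) (remQuot-combine {suc m} zero j))
         (tabulate-≟ i))
  (tabulate-cong λ x → cong (λ y → does (proj₂ y ≟ i)) (remQuot-↑ʳ m n x)))

column-zero : ∀ m n → column (suc m) n zero ≡ ⊤ {n} ++ ⊥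
column-zero m n = trans (tabulate-++ n _) (cong₂ _++_
  (trans (tabulate-cong λ j →
            cong (λ x → does (proj₁ x ≟ zero {m})) (remQuot-combine {suc m} zero j))
         (tabulate-const n inside))
  (trans (tabulate-cong λ x → cong (λ y → does (proj₁ y ≟ zero {m})) (remQuot-↑ʳ m n x))
         (tabulate-const (m * n) outside)))

column-suc : ∀ m n j → column (suc m) n (suc j) ≡ ⊥ ++ column m n j
column-suc m n j = trans (tabulate-++ n _) (cong₂ _++_
  (trans (tabulate-cong λ i →
            cong (λ x → does (proj₁ x ≟ suc j)) (remQuot-combine {suc m} zero i))
         (tabulate-const n outside))
  (tabulate-cong λ x → cong (λ y → does (proj₁ y ≟ suc j)) (remQuot-↑ʳ m n x)))

-- Rook sets of words

occupied : Slot n → Subset n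
occupied nothing  = ⊥
occupied (just i) = ⁅ i ⁆

-- Squares are numbered column by column, so each letter supplies one block of `n` bits.
rooks : Word m n → Subset (m * n)
rooks []      = []
rooks (x ∷ w) = occupied x ++ rooks w

∈-occupied : ∀ {x} {i : Fin n} → i ∈ occupied x ⇔ x ≡ just i
∈-occupied {x = nothing} = mk⇔ (λ i∈⊥ → contradiction i∈⊥ ∉⊥) λ ()
∈-occupied {x = just j}  = mk⇔ (cong just ∘ sym ∘ x∈⁅y⁆⇒x≡y j) λ { refl → x∈⁅x⁆ j }

lookup-rooks : ∀ (w : Word m n) j i →
  lookup (rooks w) (combine j i) ≡ lookup (occupied (lookup w j)) i
lookup-rooks (x ∷ w) zero    i = lookup-++ˡ (occupied x) (rooks w) i
lookup-rooks (x ∷ w) (suc j) i =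
  trans (lookup-++ʳ (occupied x) (rooks w) (combine j i)) (lookup-rooks w j i)

∈-rooks⁻ : ∀ (w : Word m n) {j i} → combine j i ∈ rooks w → lookup w j ≡ just i
∈-rooks⁻ w {j} {i} ∈w = Equivalence.to ∈-occupied
  (lookup⇒[]= i _ (trans (sym (lookup-rooks w j i)) ([]=⇒lookup ∈w)))

∈-rooks⁺ : ∀ (w : Word m n) {j i} → lookup w j ≡ just i → combine j i ∈ rooks w
∈-rooks⁺ w {j} {i} eq =
  lookup⇒[]= _ _ (trans (lookup-rooks w j i) ([]=⇒lookup (Equivalence.from ∈-occupied eq)))

⊆-by-squares : ∀ {A B : Subset (m * n)} →
  (∀ (j : Fin m) (i : Fin n) → combine j i ∈ A → combine j i ∈ B) → A ⊆ B
⊆-by-squares {m} {n} A⇒B {x} x∈A with j , i , refl ← combine-surjective {m} {n} x = A⇒B j i x∈A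

occupied-injective : ∀ {x y : Slot n} → occupied x ≡ occupied y → x ≡ y
occupied-injective {x = nothing} {nothing} eq = refl
occupied-injective {x = just i}  {y}       eq =
  sym (Equivalence.to ∈-occupied (subst (i ∈_) eq (x∈⁅x⁆ i)))
occupied-injective {x = nothing} {just j}  eq =
  Equivalence.to ∈-occupied (subst (j ∈_) (sym eq) (x∈⁅x⁆ j))

rooks-injective : ∀ (v w : Word m n) → rooks v ≡ rooks w → v ≡ w
rooks-injective []      []      eq = refl
rooks-injective (x ∷ v) (y ∷ w) eq
  with eq₁ , eq₂ ← ++-injective (occupied x) (occupied y) eq
  = cong₂ _∷_ (occupied-injective eq₁) (rooks-injective v w eq₂)

∣occupied∣≤1 : (x : Slot n) → ∣ occupied x ∣ ≤ 1
∣occupied∣≤1 {n} nothing = ℕ.≤-trans (ℕ.≤-reflexive (∣⊥∣≡0 n)) z≤n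
∣occupied∣≤1 (just i)    = ℕ.≤-reflexive (∣⁅x⁆∣≡1 i)

x≢i⇒occupied∩⁅i⁆≡⊥ : ∀ {x} {i : Fin n} → x ≢ just i → occupied x ∩ ⁅ i ⁆ ≡ ⊥
x≢i⇒occupied∩⁅i⁆≡⊥ {x = x} {i} x≢i = Empty-unique λ { (j , j∈) →
  let j∈x , j∈i = x∈p∩q⁻ (occupied x) ⁅ i ⁆ j∈ in
  x≢i (Equivalence.to ∈-occupied (subst (_∈ occupied x) (x∈⁅y⁆⇒x≡y i j∈i) j∈x)) }

-- The inductive step for counting rooks in a row: a block meets row `i` exactly when `add` raises
-- entry `i`.
∣occupied∩⁅⁆∣ : ∀ x (i : Fin n) v → ∣ occupied x ∩ ⁅ i ⁆ ∣ + lookup v i ≡ lookup (add x v) i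
∣occupied∩⁅⁆∣ {n} x i v with x ≟ˢ just i
... | yes refl rewrite ∩-idem ⁅ i ⁆ | ∣⁅x⁆∣≡1 i = sym (lookup-add i v)
... | no x≢i rewrite x≢i⇒occupied∩⁅i⁆≡⊥ x≢i | ∣⊥∣≡0 n = sym (lookup-add-≢ v x≢i)

∣rooks∩row∣ : ∀ (w : Word m n) i → ∣ rooks w ∩ row m n i ∣ ≡ lookup (content w) i
∣rooks∩row∣ []      zero    = refl
∣rooks∩row∣ {n = suc n} [] (suc i) = ∣rooks∩row∣ {n = n} [] i
∣rooks∩row∣ {suc m} {n} (x ∷ w) i = begin
  ∣ (occupied x ++ rooks w) ∩ row (suc m) n i ∣
    ≡⟨ cong (λ r → ∣ rooks (x ∷ w) ∩ r ∣) (row-suc m n i) ⟩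
  ∣ (occupied x ++ rooks w) ∩ (⁅ i ⁆ ++ row m n i) ∣
    ≡⟨ ∣++∩++∣ (occupied x) ⁅ i ⁆ (rooks w) (row m n i) ⟩
  ∣ occupied x ∩ ⁅ i ⁆ ∣ + ∣ rooks w ∩ row m n i ∣
    ≡⟨ cong (∣ occupied x ∩ ⁅ i ⁆ ∣ +_) (∣rooks∩row∣ w i) ⟩
  ∣ occupied x ∩ ⁅ i ⁆ ∣ + lookup (content w) i
    ≡⟨ ∣occupied∩⁅⁆∣ x i (content w) ⟩
  lookup (content (x ∷ w)) i ∎
  where open ≡-Reasoning

∣++∩column-zero∣ : ∀ m {n} (p : Subset n) (q : Subset (m * n)) →
  ∣ (p ++ q) ∩ column (suc m) n zero ∣ ≡ ∣ p ∣
∣++∩column-zero∣ m {n} p q = begin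
  ∣ (p ++ q) ∩ column (suc m) n zero ∣ ≡⟨ cong (λ r → ∣ (p ++ q) ∩ r ∣) (column-zero m n) ⟩
  ∣ (p ++ q) ∩ (⊤ {n} ++ ⊥) ∣          ≡⟨ ∣++∩++∣ p ⊤ q ⊥ ⟩
  ∣ p ∩ ⊤ ∣ + ∣ q ∩ ⊥ ∣
    ≡⟨ cong₂ (λ r s → ∣ r ∣ + ∣ s ∣) (∩-identityʳ p) (∩-zeroʳ q) ⟩
  ∣ p ∣ + ∣ ⊥ {m * n} ∣                ≡⟨ cong (∣ p ∣ +_) (∣⊥∣≡0 (m * n)) ⟩
  ∣ p ∣ + 0                            ≡⟨ ℕ.+-identityʳ _ ⟩
  ∣ p ∣                                ∎
  where open ≡-Reasoning

∣++∩column-suc∣ : ∀ m {n} (p : Subset n) (q : Subset (m * n)) j →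
  ∣ (p ++ q) ∩ column (suc m) n (suc j) ∣ ≡ ∣ q ∩ column m n j ∣
∣++∩column-suc∣ m {n} p q j = begin
  ∣ (p ++ q) ∩ column (suc m) n (suc j) ∣ ≡⟨ cong (λ r → ∣ (p ++ q) ∩ r ∣) (column-suc m n j) ⟩
  ∣ (p ++ q) ∩ (⊥ ++ column m n j) ∣      ≡⟨ ∣++∩++∣ p ⊥ q (column m n j) ⟩
  ∣ p ∩ ⊥ ∣ + ∣ q ∩ column m n j ∣        ≡⟨ cong (λ r → ∣ r ∣ + ∣ q ∩ column m n j ∣) (∩-zeroʳ p) ⟩
  ∣ ⊥ {n} ∣ + ∣ q ∩ column m n j ∣        ≡⟨ cong (_+ ∣ q ∩ column m n j ∣) (∣⊥∣≡0 n) ⟩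
  ∣ q ∩ column m n j ∣                    ∎
  where open ≡-Reasoning

∣rooks∩column∣≤1 : ∀ (w : Word m n) j → ∣ rooks w ∩ column m n j ∣ ≤ 1
∣rooks∩column∣≤1 {suc m} (x ∷ w) zero =
  subst (_≤ 1) (sym (∣++∩column-zero∣ m (occupied x) (rooks w))) (∣occupied∣≤1 x)
∣rooks∩column∣≤1 {suc m} (x ∷ w) (suc j) =
  subst (_≤ 1) (sym (∣++∩column-suc∣ m (occupied x) (rooks w) j)) (∣rooks∩column∣≤1 w j)

∣occupied∣ : ∀ (x : Slot n) v → ∣ occupied x ∣ + sum v ≡ sum (add x v)
∣occupied∣ {n} nothing v = cong (_+ sum v) (∣⊥∣≡0 n)
∣occupied∣ (just i)    v = trans (cong (_+ sum v) (∣⁅x⁆∣≡1 i)) (sym (sum-add (just i) v))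

∣rooks∣ : (w : Word m n) → ∣ rooks w ∣ ≡ sum (content w)
∣rooks∣ {n = n} [] = sym (sum-replicate-0 n)
∣rooks∣ (x ∷ w) = trans (∣++∣ (occupied x) (rooks w))
  (trans (cong (∣ occupied x ∣ +_) (∣rooks∣ w)) (∣occupied∣ x (content w)))

-- Recovering words from rook sets

∣p∣≡0⇒p≡⊥ : (p : Subset n) → ∣ p ∣ ≡ 0 → p ≡ ⊥
∣p∣≡0⇒p≡⊥ []            eq = refl
∣p∣≡0⇒p≡⊥ (outside ∷ p) eq = cong (outside ∷_) (∣p∣≡0⇒p≡⊥ p eq)

∣p∣≤1⇒occupied : (p : Subset n) → ∣ p ∣ ≤ 1 → ∃[ x ] occupied x ≡ p
∣p∣≤1⇒occupied []            le = nothing , refl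
∣p∣≤1⇒occupied (inside ∷ p)  (s≤s le) =
  just zero , cong (inside ∷_) (sym (∣p∣≡0⇒p≡⊥ p (ℕ.n≤0⇒n≡0 le)))
∣p∣≤1⇒occupied (outside ∷ p) le with ∣p∣≤1⇒occupied p le
... | nothing , eq = nothing , cong (outside ∷_) eq
... | just i  , eq = just (suc i) , cong (outside ∷_) eq

-- The bound on each column leaves at most one element in its block, which is then the block of a
-- letter. With `rooks-injective`, words correspond exactly to the sets obeying the column bounds.
columns⇒word : ∀ m {n} (A : Subset (m * n)) → (∀ j → ∣ A ∩ column m n j ∣ ≤ 1) →
  ∃[ w ] rooks {m} {n} w ≡ A
columns⇒word zero        []  _    = [] , refl
columns⇒word (suc m) {n} A   cols with p , q , refl ← splitAt n A
  with x , refl ← ∣p∣≤1⇒occupied p (subst (_≤ 1) (∣++∩column-zero∣ m p q) (cols zero))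
  with w , refl ← columns⇒word m q
         (λ j → subst (_≤ 1) (∣++∩column-suc∣ m p q j) (cols (suc j)))
  = x ∷ w , refl

-- Comparing sums and cardinalities

sum-mono-≤ : ∀ (u v : Vec ℕ n) → (∀ i → lookup u i ≤ lookup v i) → sum u ≤ sum v
sum-mono-≤ []      []      u≤v = z≤n
sum-mono-≤ (_ ∷ u) (_ ∷ v) u≤v = ℕ.+-mono-≤ (u≤v zero) (sum-mono-≤ u v (u≤v ∘ suc))

sum-mono-< : ∀ (u v : Vec ℕ n) → (∀ i → lookup u i ≤ lookup v i) →
  ∀ i → lookup u i < lookup v i → sum u < sum v
sum-mono-< (_ ∷ u) (_ ∷ v) u≤v zero    lt = ℕ.+-mono-<-≤ lt (sum-mono-≤ u v (u≤v ∘ suc))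
sum-mono-< (_ ∷ u) (_ ∷ v) u≤v (suc i) lt =
  ℕ.+-mono-≤-< (u≤v zero) (sum-mono-< u v (u≤v ∘ suc) i lt)

⊆∧∣≥∣⇒≡ : ∀ {p q : Subset n} → p ⊆ q → ∣ q ∣ ≤ ∣ p ∣ → p ≡ q
⊆∧∣≥∣⇒≡ {p = p} p⊆q ∣q∣≤∣p∣ = ⊆-antisym p⊆q λ {x} x∈q → case-∈ x∈q (x ∈? p)
  where
  case-∈ : ∀ {x} → x ∈ _ → _ → x ∈ p
  case-∈ x∈q (yes x∈p) = x∈p
  case-∈ x∈q (no x∉p)  = contradiction (p⊂q⇒∣p∣<∣q∣ (p⊆q , _ , x∈q , x∉p)) (ℕ.≤⇒≯ ∣q∣≤∣p∣)

-- Removing `x` a second time changes nothing, whereas removing a present element gives a proper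
-- subset.
x∉p-x : ∀ (p : Subset n) x → x ∉ p - x
x∉p-x p x x∈p-x = ⊂-irref (p─q─q≡p─q p ⁅ x ⁆) (x∈p⇒p-x⊂p x∈p-x)

-- The effect of an exchange on rook sets

module _ (b : Word m n) {p q : Fin m} {i : Fin n}
         (b∋i : lookup b p ≡ just i) (b∋∅ : lookup b q ≡ nothing) where

  private
    q≢p : q ≢ p
    q≢p refl with () ← trans (sym b∋i) b∋∅

    v : Fin (m * n)
    v = combine p i

  lookup-removed : lookup (b [ p ]≔ nothing) q ≡ nothing
  lookup-removed = trans (lookup∘update′ q≢p b nothing) b∋∅

  v∉exchange : v ∉ rooks (exchange b p q i)
  v∉exchange v∈ with () ← trans (sym (∈-rooks⁻ (exchange b p q i) v∈))
    (trans (lookup∘update′ (q≢p ∘ sym) (b [ p ]≔ nothing) (just i)) (lookup∘update p b nothing))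

  -- Only columns `p` and `q` are altered; `b` has just the rook `v` in the first and none in the
  -- second.
  rooks-exchange : ∀ {x} → x ∈ rooks b → x ≢ v → x ∈ rooks (exchange b p q i)
  rooks-exchange {x} x∈b x≢v with j , i′ , refl ← combine-surjective {m} {n} x =
    ∈-rooks⁺ (exchange b p q i)
      (trans (lookup∘update′ j≢q (b [ p ]≔ nothing) (just i))
        (trans (lookup∘update′ j≢p b nothing) b∋i′))
    where
    b∋i′ : lookup b j ≡ just i′
    b∋i′ = ∈-rooks⁻ b x∈b

    j≢q : j ≢ q
    j≢q refl with () ← trans (sym b∋i′) b∋∅

    j≢p : j ≢ p
    j≢p refl with refl ← trans (sym b∋i′) b∋i = x≢v refl

  exchange-∩ : rooks (exchange b p q i) ∩ rooks b ≡ rooks b - v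
  exchange-∩ = ⊆-antisym
    (λ x∈ → let x∈c , x∈b = x∈p∩q⁻ _ (rooks b) x∈ in
      x∈p∧x≢y⇒x∈p-y x∈b λ { refl → v∉exchange x∈c })
    (λ x∈ → let x∈b = p─q⊆p (rooks b) ⁅ v ⁆ x∈ in
      x∈p∩q⁺ (rooks-exchange x∈b (λ { refl → x∉p-x (rooks b) v x∈ }) , x∈b))

  -- Since `v` is not a rook of `a`, every common rook differs from `v` and survives the exchange.
  ∩-exchange : ∀ a → lookup a p ≢ just i →
    rooks a ∩ rooks b ⊆ rooks (exchange b p q i) ∩ rooks b
  ∩-exchange a a∌i x∈ with x∈a , x∈b ← x∈p∩q⁻ (rooks a) (rooks b) x∈ =
    x∈p∩q⁺ (rooks-exchange x∈b (λ { refl → a∌i (∈-rooks⁻ a x∈a) }) , x∈b)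

-- Facets as words of content `k`

module _ {m n : ℕ} (k : Vec ℕ n) where

  rookPlacement⁺ : ∀ (w : Word m n) → (∀ i → lookup (content w) i ≤ lookup k i) →
    RookPlacement m n k (rooks w)
  rookPlacement⁺ w rows =
    (λ i → subst (_≤ lookup k i) (sym (∣rooks∩row∣ w i)) (rows i)) , ∣rooks∩column∣≤1 w

  rookPlacement⁻ : ∀ (w : Word m n) → RookPlacement m n k (rooks w) →
    ∀ i → lookup (content w) i ≤ lookup k i
  rookPlacement⁻ w (rows , _) i = subst (_≤ lookup k i) (∣rooks∩row∣ w i) (rows i)

  -- A placement has as many rooks as its content sums to, at most `sum k`; `w` attains this bound,
  -- so no placement properly contains it.
  content≡k⇒facet : ∀ (w : Word m n) → content w ≡ k → IsFacet (Chessboard m n k) (rooks w)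
  content≡k⇒facet w refl = rookPlacement⁺ w (λ i → ℕ.≤-refl) , maximal
    where
    maximal : ∀ B → RookPlacement m n k B → rooks w ⊆ B → rooks w ≡ B
    maximal B placement w⊆B with w′ , refl ← columns⇒word m B (proj₂ placement) =
      ⊆∧∣≥∣⇒≡ w⊆B (subst₂ _≤_ (sym (∣rooks∣ w′)) (sym (∣rooks∣ w))
        (sum-mono-≤ (content w′) k (rookPlacement⁻ w′ placement)))

  -- If row `i` were not full, there would be fewer than `sum k ≤ m` rooks, hence an empty column; a
  -- rook of row `i` placed there contradicts maximality.
  facet⇒content≡k : sum k ≤ m → ∀ (w : Word m n) → IsFacet (Chessboard m n k) (rooks w) →
    content w ≡ k
  facet⇒content≡k sum≤m w (placement , maximal) =
    Pointwise.Pointwise-≡⇒≡ (Pointwise.ext λ i → ℕ.≤∧≮⇒≡ (rows i) (full i))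
    where
    rows : ∀ i → lookup (content w) i ≤ lookup k i
    rows = rookPlacement⁻ w placement

    full : ∀ i → ¬ (lookup (content w) i < lookup k i)
    full i lt with free-position w
    ... | inj₂ none = ℕ.<⇒≱ (sum-mono-< (content w) k rows i lt)
            (ℕ.≤-trans sum≤m (ℕ.≤-reflexive
              (trans (sym (free+sum-content w)) (cong (_+ sum (content w)) none))))
    ... | inj₁ (q , w∋∅) = contradiction
            (trans (sym w∋∅) (∈-rooks⁻ w (subst (_ ∈_) (sym w≡w′)
              (∈-rooks⁺ w′ (lookup∘update q w (just i))))))
            λ ()
      where
      w′ : Word m n
      w′ = w [ q ]≔ just i

      content-w′ : content w′ ≡ add (just i) (content w)
      -- The old letter at `q` is empty, so adding it changes nothing and `content-≔` applies.
      content-w′ = trans (cong (λ x → add x (content w′)) (sym w∋∅)) (content-≔ w q (just i))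

      rows′ : ∀ j → lookup (content w′) j ≤ lookup k j
      rows′ j rewrite content-w′ with i ≟ j
      ... | yes refl = ℕ.≤-trans (ℕ.≤-reflexive (lookup-add i (content w))) lt
      ... | no i≢j   = ℕ.≤-trans
              (ℕ.≤-reflexive (lookup-add-≢ (content w) (i≢j ∘ just-injective))) (rows j)

      w⊆w′ : rooks w ⊆ rooks w′
      w⊆w′ = ⊆-by-squares {m} {n} λ j i′ ∈w →
        let w∋i′ = ∈-rooks⁻ w ∈w in
        ∈-rooks⁺ w′ (trans (lookup∘update′
          (λ { refl → contradiction (trans (sym w∋∅) w∋i′) λ () }) w (just i)) w∋i′)

      w≡w′ : rooks w ≡ rooks w′
      w≡w′ = maximal (rooks w′) (rookPlacement⁺ w′ rows′) w⊆w′

  private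
    K : SimplicialComplex (m * n)
    K = Chessboard m n k

  -- The shelling order on facets

  word : Facet K → Word m n
  word (A , (_ , columns) , _) = proj₁ (columns⇒word m A columns)

  rooks-word : ∀ F → rooks (word F) ≡ proj₁ F
  rooks-word (A , (_ , columns) , _) = proj₂ (columns⇒word m A columns)

  -- `word` is computed from the column proofs stored in a facet, which may differ for equal sets;
  -- injectivity of `rooks` removes this dependence.
  word-cong : ∀ F G → _≈_ K F G → word F ≡ word G
  word-cong F G F≈G =
    rooks-injective _ _ (trans (rooks-word F) (trans F≈G (sym (rooks-word G))))

  _≪_ : Rel (Facet K) _
  _≪_ = 0 ⊢_≺_ on word

  ≪-compare : Trichotomous (_≈_ K) _≪_
  ≪-compare F G with ≺-compare 0 (word F) (word G)
  ... | tri< lt neq ngt = tri< lt (neq ∘ word-cong F G) ngt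
  ... | tri≈ nlt eq ngt =
    tri≈ nlt (trans (sym (rooks-word F)) (trans (cong rooks eq) (rooks-word G))) ngt
  ... | tri> nlt neq gt = tri> nlt (neq ∘ word-cong F G) gt

  ≪-isStrictTotalOrder : IsStrictTotalOrder (_≈_ K) _≪_
  ≪-isStrictTotalOrder = isStrictTotalOrderᶜ record
    { isEquivalence = On.isEquivalence proj₁ isEquivalence
    ; trans         = ≺-trans
    ; compare       = ≪-compare
    }

  module _ (sum≤m : sum k ≤ m) where

    content-word : ∀ F → content (word F) ≡ k
    content-word F = facet⇒content≡k sum≤m (word F)
      (subst (IsFacet K) (sym (rooks-word F)) (proj₂ F))

    pure : Pure K
    pure F G = trans (size F) (sym (size G))
      where
      size : ∀ F → ∣ proj₁ F ∣ ≡ sum k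
      size F = trans (cong ∣_∣ (sym (rooks-word F)))
        (trans (∣rooks∣ (word F)) (cong sum (content-word F)))

    ≪-isShellingOrder : sum k + n ≤ suc m → IsShellingOrder K _≪_
    ≪-isShellingOrder enough = record
      { isStrictTotalOrder = ≪-isStrictTotalOrder
      ; shelling           = shelling
      }
      where
      n≤1+free : ∀ (w : Word m n) → content w ≡ k → n ≤ suc (free w)
      -- Here `m` is `free w + sum k`, so `sum k` cancels from `enough`.
      n≤1+free w refl = ℕ.+-cancelˡ-≤ (sum k) _ _ (ℕ.≤-trans enough (ℕ.≤-reflexive
        (trans (cong suc (trans (sym (free+sum-content w)) (ℕ.+-comm (free w) (sum k))))
               (sym (ℕ.+-suc (sum k) (free w))))))

      shelling : ∀ F G → F ≪ G → let A = proj₁ F ; B = proj₁ G in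
        ∃[ H ] H ≪ G × (let C = proj₁ H in
          ∃[ v ] v ∈ B × A ∩ B ⊆ C ∩ B × C ∩ B ≡ B - v)
      shelling F G F≪G
        with exchange-exists (trans (content-word F) (sym (content-word G)))
               (n≤1+free (word G) (content-word G)) F≪G
      ... | exchanging p q i b∋i a∌i b∋∅ less =
        -- The exchanged word gives the earlier facet, and the vacated square gives the vertex.
        H , subst (0 ⊢_≺ b) (sym word-H) less , combine p i ,
        subst (combine p i ∈_) (rooks-word G) (∈-rooks⁺ b b∋i) ,
        subst₂ (λ A B → A ∩ B ⊆ rooks b′ ∩ B) (rooks-word F) (rooks-word G)
          (∩-exchange b b∋i b∋∅ (word F) a∌i) ,
        subst (λ B → rooks b′ ∩ B ≡ B - combine p i) (rooks-word G) (exchange-∩ b b∋i b∋∅)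
        where
        b b′ : Word m n
        b = word G
        b′ = exchange b p q i

        H : Facet K
        H = rooks b′ , content≡k⇒facet b′
          (trans (content-exchange b b∋i (lookup-removed b b∋i b∋∅)) (content-word G))

        word-H : word H ≡ b′
        word-H = rooks-injective _ _ (rooks-word H)

theorem4p4 : ∀ (m n : ℕ) → 1 ≤ m → 1 ≤ n → (k : Vec ℕ n) →
    m ≥ (sum k + n) ∸ 1 → Shellable (Chessboard m n k)
theorem4p4 m n@(suc n′) _ _ k m≥ = pure k sum≤m , _≪_ k , ≪-isShellingOrder k sum≤m enough
  where
  enough : sum k + n ≤ suc m
  -- Moving the 1 across turns the truncated subtraction into a plain sum.
  enough = ℕ.≤-trans (ℕ.m≤n+m∸n (sum k + n) 1) (s≤s m≥)

  sum≤m : sum k ≤ m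
  -- As `n` is `suc n′`, one successor cancels and leaves `sum k + n′ ≤ m`.
  sum≤m = ℕ.≤-trans (ℕ.m≤m+n (sum k) n′) (ℕ.s≤s⁻¹ (subst (_≤ suc m) (ℕ.+-suc (sum k) n′) enough))
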